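{- For the equational theory axiomatizing equivalence in the modal logic $\mathsf{K}$, the restricted and the unrestricted unification types (for elementary unification) coincide, and the type is thus zero in both cases.
   Context: The theory $\mathsf{K}$: the signature $\Sigma$ consists of the constants $\top,\bot$, the unary symbols $\neg$, $\Box_r$ and $\Diamond_r$ (for $r$ in a finite non-empty index set), and the binary symbols $\wedge,\vee$. The identities are those axiomatizing Boolean algebras for $\wedge,\vee,\neg,\top,\bot$, together with $\Box_r(x\wedge y)\approx\Box_r x\wedge\Box_r y$, $\Box_r\top\approx\top$, and $\Diamond_r x\approx\neg\Box_r\neg x$ for each $r$. Let $V$ be a countably infinite set of variables and $T(\Sigma,V)$ the set of terms. For an equational theory $E$, i.e., a set of (implicitly universally quantified) identities between terms, $\approx_E$ is the congruence relation on $T(\Sigma,V)$ it induces ($s\approx_E t$ iff $s\approx t$ holds in all models of $E$). A substitution is a map $\sigma:V\to T(\Sigma,V)$ with finite domain $\{x\in V\mid\sigma(x)\neq x\}$, extended homomorphically to terms. For $X\subseteq V$, $\sigma\leq_E^X\tau$ iff there is a substitution $\lambda$ with $\lambda(\sigma(x))\approx_E\tau(x)$ for all $x\in X$. An $E$-unification problem is a finite set $\Gamma=\{s_1\approx_E^? t_1,\ldots,s_n\approx_E^? t_n\}$ of equations between terms in $T(\Sigma,V)$; $\mathrm{Var}(\Gamma)$ is the set of variables occurring in it. Elementary unification means that $\Sigma$ contains only function symbols occurring in $E$. An $E$-unifier of $\Gamma$ is a substitution $\sigma$ with $\sigma(s_i)\approx_E\sigma(t_i)$ for all $i$; $\Gamma$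 is solvable if it has an $E$-unifier. For $\mathrm{Var}(\Gamma)\subseteq X\subseteq V$, a set $S$ of $E$-unifiers of $\Gamma$ is complete w.r.t. $\leq_E^X$ if for every $E$-unifier $\theta$ of $\Gamma$ there is $\sigma\in S$ with $\sigma\leq_E^X\theta$; it is minimal if no two distinct elements of $S$ are comparable w.r.t. $\leq_E^X$. Minimal complete sets of the same problem (w.r.t. the same $X$) all have the same cardinality. The unification type of a solvable $\Gamma$ w.r.t. $\leq_E^X$ is: unitary if $\Gamma$ has a minimal complete set of cardinality one; finitary if it has a finite minimal complete set of cardinality greater than one; infinitary if it has an infinite minimal complete set; zero if it has no minimal complete set. The restricted type of $\Gamma$ is the one w.r.t. $\leq_E^{\mathrm{Var}(\Gamma)}$ and the unrestricted type the one w.r.t. $\leq_E^V$. Types are ordered by zero $>$ infinitary $>$ finitary $>$ unitary, and the restricted (unrestricted) type of $E$ is the largest (worst) restricted (unrestricted) type of any solvable $E$-unification problem. -}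

module Defs where

open import Level using (Level; 0ℓ) renaming (suc to lsuc; _⊔_ to _⊔ˡ_)
open import Data.Nat using (ℕ; _≤_; _<_)
open import Data.Fin using (Fin)
open import Data.List using (List; []; _∷_; [_]; _++_; concatMap)
open import Data.List.Membership.Propositional using (_∈_)
open import Data.List.Relation.Unary.All using (All)
open import Data.Product using (Σ; ∃; ∃-syntax; _×_; _,_; proj₁)
open import Data.Sum using (_⊎_)
open import Relation.Nullary using (¬_)
open import Relation.Unary using (Pred; U)
open import Relation.Binary.Bundles using (Setoid)
open import Relation.Binary.PropositionalEquality as ≡ using (_≡_; _≗_)
open import Function.Bundles using (Bijection)
open import Function.Base using (_∘_)
import Relation.Binary.Construct.On as On

infix  9 ¬ᵗ_
infixr 7 _∧ᵗ_
infixr 6 _∨ᵗ_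

-- Variables are natural numbers; I is the index set of the modalities.
data Term (I : Set) : Set where
  var   : ℕ → Term I
  ⊤ᵗ ⊥ᵗ : Term I
  ¬ᵗ_   : Term I → Term I
  □ ◇   : I → Term I → Term I
  _∧ᵗ_  : Term I → Term I → Term I
  _∨ᵗ_  : Term I → Term I → Term I

-- A theory is a set of identities: E s t means that s ≈ t belongs to E.
Theory : Set → Set₁
Theory I = Term I → Term I → Set

-- The Boolean part lists the laws of the library's IsBooleanAlgebra; the
-- unit laws for ⊤ and ⊥ follow from absorption and the complement laws.
data K (I : Set) : Theory I where
  ∨-comm        : K I (var 0 ∨ᵗ var 1) (var 1 ∨ᵗ var 0)
  ∨-assoc       : K I ((var 0 ∨ᵗ var 1) ∨ᵗ var 2) (var 0 ∨ᵗ (var 1 ∨ᵗ var 2))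
  ∧-comm        : K I (var 0 ∧ᵗ var 1) (var 1 ∧ᵗ var 0)
  ∧-assoc       : K I ((var 0 ∧ᵗ var 1) ∧ᵗ var 2) (var 0 ∧ᵗ (var 1 ∧ᵗ var 2))
  ∨-absorbs-∧   : K I (var 0 ∨ᵗ (var 0 ∧ᵗ var 1)) (var 0)
  ∧-absorbs-∨   : K I (var 0 ∧ᵗ (var 0 ∨ᵗ var 1)) (var 0)
  ∨-distribˡ-∧  : K I (var 0 ∨ᵗ (var 1 ∧ᵗ var 2)) ((var 0 ∨ᵗ var 1) ∧ᵗ (var 0 ∨ᵗ var 2))
  ∧-distribˡ-∨  : K I (var 0 ∧ᵗ (var 1 ∨ᵗ var 2)) ((var 0 ∧ᵗ var 1) ∨ᵗ (var 0 ∧ᵗ var 2))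
  ∨-complementʳ : K I (var 0 ∨ᵗ ¬ᵗ var 0) ⊤ᵗ
  ∧-complementʳ : K I (var 0 ∧ᵗ ¬ᵗ var 0) ⊥ᵗ
  □-∧           : ∀ r → K I (□ r (var 0 ∧ᵗ var 1)) (□ r (var 0) ∧ᵗ □ r (var 1))
  □-⊤           : ∀ r → K I (□ r ⊤ᵗ) ⊤ᵗ
  ◇-def         : ∀ r → K I (◇ r (var 0)) (¬ᵗ □ r (¬ᵗ var 0))

-- Carriers are setoids, which stand in for quotient sets.
record Algebra (I : Set) : Set₁ where
  field
    setoid : Setoid 0ℓ 0ℓ
  open Setoid setoid public
  field
    ⊤ᴬ ⊥ᴬ : Carrier
    ¬ᴬ    : Carrier → Carrier
    □ᴬ ◇ᴬ : I → Carrier → Carrier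
    ∧ᴬ ∨ᴬ : Carrier → Carrier → Carrier
    ¬-cong : ∀ {a b} → a ≈ b → ¬ᴬ a ≈ ¬ᴬ b
    □-cong : ∀ r {a b} → a ≈ b → □ᴬ r a ≈ □ᴬ r b
    ◇-cong : ∀ r {a b} → a ≈ b → ◇ᴬ r a ≈ ◇ᴬ r b
    ∧-cong : ∀ {a b c d} → a ≈ b → c ≈ d → ∧ᴬ a c ≈ ∧ᴬ b d
    ∨-cong : ∀ {a b c d} → a ≈ b → c ≈ d → ∨ᴬ a c ≈ ∨ᴬ b d

  eval : (ℕ → Carrier) → Term I → Carrier
  eval ρ (var x)  = ρ x
  eval ρ ⊤ᵗ       = ⊤ᴬ
  eval ρ ⊥ᵗ       = ⊥ᴬ
  eval ρ (¬ᵗ s)   = ¬ᴬ (eval ρ s)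
  eval ρ (□ r s)  = □ᴬ r (eval ρ s)
  eval ρ (◇ r s)  = ◇ᴬ r (eval ρ s)
  eval ρ (s ∧ᵗ t) = ∧ᴬ (eval ρ s) (eval ρ t)
  eval ρ (s ∨ᵗ t) = ∨ᴬ (eval ρ s) (eval ρ t)

  Satisfies : Term I → Term I → Set
  Satisfies s t = ∀ ρ → eval ρ s ≈ eval ρ t

IsModel : ∀ {I} → Theory I → Algebra I → Set
IsModel E A = ∀ {s t} → E s t → Algebra.Satisfies A s t

_⊢_≈_ : ∀ {I} → Theory I → Term I → Term I → Set₁
E ⊢ s ≈ t = ∀ A → IsModel E A → Algebra.Satisfies A s t

record Subst (I : Set) : Set where
  field
    map           : ℕ → Term I
    finite-domain : ∃[ xs ] (∀ x → ¬ (map x ≡ var x) → x ∈ xs)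
open Subst public

_⟦_⟧ : ∀ {I} → Subst I → Term I → Term I
σ ⟦ var x ⟧  = map σ x
σ ⟦ ⊤ᵗ ⟧     = ⊤ᵗ
σ ⟦ ⊥ᵗ ⟧     = ⊥ᵗ
σ ⟦ ¬ᵗ s ⟧   = ¬ᵗ (σ ⟦ s ⟧)
σ ⟦ □ r s ⟧  = □ r (σ ⟦ s ⟧)
σ ⟦ ◇ r s ⟧  = ◇ r (σ ⟦ s ⟧)
σ ⟦ s ∧ᵗ t ⟧ = (σ ⟦ s ⟧) ∧ᵗ (σ ⟦ t ⟧)
σ ⟦ s ∨ᵗ t ⟧ = (σ ⟦ s ⟧) ∨ᵗ (σ ⟦ t ⟧)

-- Equality of substitutions is pointwise syntactic equality; the evidence
-- for finiteness of the domain is ignored.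
Subst-setoid : Set → Setoid 0ℓ 0ℓ
Subst-setoid I = On.setoid (ℕ ≡.→-setoid Term I) (map {I})

vars : ∀ {I} → Term I → List ℕ
vars (var x)  = [ x ]
vars ⊤ᵗ       = []
vars ⊥ᵗ       = []
vars (¬ᵗ s)   = vars s
vars (□ r s)  = vars s
vars (◇ r s)  = vars s
vars (s ∧ᵗ t) = vars s ++ vars t
vars (s ∨ᵗ t) = vars s ++ vars t

Problem : Set → Set
Problem I = List (Term I × Term I)

Var : ∀ {I} → Problem I → Pred ℕ 0ℓ
Var Γ x = x ∈ concatMap (λ (s , t) → vars s ++ vars t) Γ

data UnificationType : Set where
  unitary finitary infinitary zero : UnificationType

rank : UnificationType → ℕ
rank unitary    = 0
rank finitary   = 1
rank infinitary = 2
rank zero       = 3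

_≤ᵁ_ : UnificationType → UnificationType → Set
s ≤ᵁ t = rank s ≤ rank t

module _ {I : Set} (E : Theory I) where

  MoreGeneral : Pred ℕ 0ℓ → Subst I → Subst I → Set₁
  MoreGeneral X σ τ = ∃[ ρ ] (∀ x → X x → E ⊢ ρ ⟦ map σ x ⟧ ≈ map τ x)

  Unifier : Problem I → Subst I → Set₁
  Unifier Γ σ = All (λ (s , t) → E ⊢ σ ⟦ s ⟧ ≈ (σ ⟦ t ⟧)) Γ

  Solvable : Problem I → Set₁
  Solvable Γ = ∃[ σ ] Unifier Γ σ

module _ {I : Set} {ℓ : Level} where

  Elements : Pred (Subst I) ℓ → Setoid ℓ 0ℓ
  Elements S = On.setoid (Subst-setoid I) (proj₁ {B = S})

  HasCardinality : Pred (Subst I) ℓ → ℕ → Set ℓ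
  HasCardinality S n = Bijection (≡.setoid (Fin n)) (Elements S)

  Infinite : Pred (Subst I) ℓ → Set ℓ
  Infinite S = ∀ n → ¬ HasCardinality S n

module _ {I : Set} (E : Theory I) where

  record IsMinimalComplete {ℓ} (Γ : Problem I) (X : Pred ℕ 0ℓ)
                           (S : Pred (Subst I) ℓ) : Set (lsuc 0ℓ ⊔ˡ ℓ) where
    field
      unifiers : ∀ σ → S σ → Unifier E Γ σ
      complete : ∀ θ → Unifier E Γ θ → ∃[ σ ] (S σ × MoreGeneral E X σ θ)
      minimal  : ∀ σ τ → S σ → S τ → ¬ (map σ ≗ map τ) →
                 ¬ (MoreGeneral E X σ τ ⊎ MoreGeneral E X τ σ)

  -- The level ℓ is the universe in which sets of substitutions live.
  -- X is assumed to contain Var Γ, as it does in both instances below.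
  HasType : (ℓ : Level) → Problem I → Pred ℕ 0ℓ → UnificationType → Set (lsuc ℓ)
  HasType ℓ Γ X unitary    = Σ (Pred (Subst I) ℓ) λ S →
                             IsMinimalComplete Γ X S × HasCardinality S 1
  HasType ℓ Γ X finitary   = Σ (Pred (Subst I) ℓ) λ S →
                             IsMinimalComplete Γ X S × ∃[ n ] (1 < n × HasCardinality S n)
  HasType ℓ Γ X infinitary = Σ (Pred (Subst I) ℓ) λ S →
                             IsMinimalComplete Γ X S × Infinite S
  HasType ℓ Γ X zero       = ¬ Σ (Pred (Subst I) ℓ) λ S → IsMinimalComplete Γ X S

  WorstType : (ℓ : Level) → (Problem I → Pred ℕ 0ℓ) → UnificationType → Set (lsuc ℓ)
  WorstType ℓ X t =
    (∃[ Γ ] (Solvable E Γ × HasType ℓ Γ (X Γ) t)) ×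
    (∀ Γ u → Solvable E Γ → HasType ℓ Γ (X Γ) u → u ≤ᵁ t)

  RestrictedType : (ℓ : Level) → UnificationType → Set (lsuc ℓ)
  RestrictedType ℓ = WorstType ℓ Var

  UnrestrictedType : (ℓ : Level) → UnificationType → Set (lsuc ℓ)
  UnrestrictedType ℓ = WorstType ℓ (λ _ → U)

{-# OPTIONS --safe #-}
-- The problem x ∧ □x ≈ x has the unifiers x ↦ bounded x n, where bounded x n is
-- x ∧ □(x ∧ □(… □⊥)), each strictly more general than the previous one.
-- Let τ be a member of a minimal complete set that is more general than x ↦ ⊥, and
-- let φ = τ(x) have depth d. Stack copies of a K-algebra in layers, the box of each layer
-- looking at the layer below. Evaluate φ at the bottom layer under the substitution
-- that sends φ to ⊥, and at all higher layers under a given valuation. At layer d + 1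
-- the bottom is invisible to φ, while φ ≤ □φ pulls ⊥ up from the bottom, so that φ
-- implies □ⁿ⊥ with n = d + 1. Hence x ↦ bounded x (n + 1) is more general than τ. By
-- minimality the member of the set that is more general than this unifier is τ itself, so
-- that bounded x (n + 1) implies □ⁿ⊥, which fails in a chain of n + 1 points.
module Submission where

open import Defs
open import Level using (Level)
open import Data.Nat using (ℕ; zero; suc; _≤_; _⊔_; z≤n; s≤s)
open import Data.Nat.Properties using (_≟_; ≤-refl; ≤-antisym; m⊔n≤o⇒m≤o; m⊔n≤o⇒n≤o)
open import Data.Fin using (Fin)
import Data.Fin as Fin
open import Data.Bool using (Bool; true; false; not; _∧_; _∨_)
import Data.Bool.Properties as Bool
open import Data.List using ([]; _∷_; [_]; _++_)
open import Data.List.Membership.DecPropositional _≟_ using (_∈?_)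
open import Data.List.Membership.Propositional.Properties using (∈-++⁺ˡ; ∈-++⁺ʳ)
open import Data.List.Relation.Unary.All using ([]; _∷_)
open import Data.List.Relation.Unary.Any using (here)
open import Data.Product using (_×_; _,_)
open import Data.Sum using (inj₁)
open import Data.Unit using (tt)
open import Function.Base using (_∘_)
open import Function.Bundles using (_⇔_; mk⇔)
open import Relation.Binary.PropositionalEquality
  using (_≡_; refl; sym; trans; cong; cong₂; subst; subst₂; _≗_)
open import Relation.Nullary using (¬_; contradiction)
open import Relation.Nullary.Decidable using (decidable-stable)
open import Relation.Unary using (Pred; U)
import Relation.Binary.PropositionalEquality as ≡
import Relation.Binary.Lattice.Bundles as Order
import Relation.Binary.Lattice.Properties.MeetSemilattice as MeetProperties
open import Algebra.Lattice.Bundles using (BooleanAlgebra)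
import Algebra.Lattice.Properties.BooleanAlgebra as BooleanProperties
import Algebra.Lattice.Structures.Biased as Biased
open import Algebra.Consequences.Setoid using (comm∧distrˡ⇒distr)
import Function.Indexed.Relation.Binary.Equality as Indexed
import Relation.Binary.Indexed.Heterogeneous.Construct.Trivial as Trivial

module _ {I : Set} where

  -- Substitution and composition.

  eval-⟦⟧ : ∀ (A : Algebra I) σ ρ s →
            Algebra.eval A ρ (σ ⟦ s ⟧) ≡ Algebra.eval A (Algebra.eval A ρ ∘ map σ) s
  eval-⟦⟧ A σ ρ (var x)  = refl
  eval-⟦⟧ A σ ρ ⊤ᵗ       = refl
  eval-⟦⟧ A σ ρ ⊥ᵗ       = refl
  eval-⟦⟧ A σ ρ (¬ᵗ s)   = cong (Algebra.¬ᴬ A) (eval-⟦⟧ A σ ρ s)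
  eval-⟦⟧ A σ ρ (□ r s)  = cong (Algebra.□ᴬ A r) (eval-⟦⟧ A σ ρ s)
  eval-⟦⟧ A σ ρ (◇ r s)  = cong (Algebra.◇ᴬ A r) (eval-⟦⟧ A σ ρ s)
  eval-⟦⟧ A σ ρ (s ∧ᵗ t) = cong₂ (Algebra.∧ᴬ A) (eval-⟦⟧ A σ ρ s) (eval-⟦⟧ A σ ρ t)
  eval-⟦⟧ A σ ρ (s ∨ᵗ t) = cong₂ (Algebra.∨ᴬ A) (eval-⟦⟧ A σ ρ s) (eval-⟦⟧ A σ ρ t)

  ⊢-⟦⟧ : ∀ {E : Theory I} σ s t → E ⊢ s ≈ t → E ⊢ σ ⟦ s ⟧ ≈ (σ ⟦ t ⟧)
  ⊢-⟦⟧ σ s t s≈t A M ρ =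
    subst₂ (Algebra._≈_ A) (sym (eval-⟦⟧ A σ ρ s)) (sym (eval-⟦⟧ A σ ρ t)) (s≈t A M _)

  infixr 9 _∘ˢ_

  _∘ˢ_ : Subst I → Subst I → Subst I
  map (β ∘ˢ α) x = β ⟦ map α x ⟧
  finite-domain (β ∘ˢ α) with finite-domain β | finite-domain α
  ... | xs , dom-β | ys , dom-α = xs ++ ys , λ x βαx≢x →
    -- Membership in a list of numbers is decidable, so arguing by contradiction is sound here;
    -- outside the lists, that `α` and `β` fix `x` is known only up to double negation.
    decidable-stable (x ∈? (xs ++ ys)) λ x∉ →
      x∉ (∈-++⁺ʳ xs (dom-α x λ αx≡x →
        x∉ (∈-++⁺ˡ (dom-β x λ βx≡x →
          βαx≢x (trans (cong (β ⟦_⟧) αx≡x) βx≡x)))))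

  ⟦⟧-∘ : ∀ β α s → (β ∘ˢ α) ⟦ s ⟧ ≡ β ⟦ α ⟦ s ⟧ ⟧
  ⟦⟧-∘ β α (var x)  = refl
  ⟦⟧-∘ β α ⊤ᵗ       = refl
  ⟦⟧-∘ β α ⊥ᵗ       = refl
  ⟦⟧-∘ β α (¬ᵗ s)   = cong ¬ᵗ_ (⟦⟧-∘ β α s)
  ⟦⟧-∘ β α (□ r s)  = cong (□ r) (⟦⟧-∘ β α s)
  ⟦⟧-∘ β α (◇ r s)  = cong (◇ r) (⟦⟧-∘ β α s)
  ⟦⟧-∘ β α (s ∧ᵗ t) = cong₂ _∧ᵗ_ (⟦⟧-∘ β α s) (⟦⟧-∘ β α t)
  ⟦⟧-∘ β α (s ∨ᵗ t) = cong₂ _∨ᵗ_ (⟦⟧-∘ β α s) (⟦⟧-∘ β α t)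

  MoreGeneral-trans : ∀ (E : Theory I) (X : Pred ℕ _) ρ σ τ →
                      MoreGeneral E X ρ σ → MoreGeneral E X σ τ → MoreGeneral E X ρ τ
  MoreGeneral-trans E X ρ σ τ (α , αρ≈σ) (β , βσ≈τ) = β ∘ˢ α , λ x x∈X A M ν →
    Algebra.trans A
      (Algebra.reflexive A (cong (Algebra.eval A ν) (⟦⟧-∘ β α (map ρ x))))
      (Algebra.trans A (⊢-⟦⟧ β (α ⟦ map ρ x ⟧) (map σ x) (αρ≈σ x x∈X) A M ν) (βσ≈τ x x∈X A M ν))

  _↦₀ : Term I → Subst I
  map (t ↦₀) zero    = t
  map (t ↦₀) (suc x) = var (suc x)
  finite-domain (t ↦₀) = [ 0 ] , λ where
    zero    _   → here refl
    (suc x) x≢x → contradiction refl x≢x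

  -- Modal depth and the formulas behind the approximants.

  depth : Term I → ℕ
  depth (var x)  = 0
  depth ⊤ᵗ       = 0
  depth ⊥ᵗ       = 0
  depth (¬ᵗ s)   = depth s
  depth (□ r s)  = suc (depth s)
  depth (◇ r s)  = suc (depth s)
  depth (s ∧ᵗ t) = depth s ⊔ depth t
  depth (s ∨ᵗ t) = depth s ⊔ depth t

  -- In a Kripke model: every r-path from here has fewer than n points, and p holds along
  -- all of them. In particular bounded r ⊤ᵗ n is □ⁿ⊥.
  bounded : I → Term I → ℕ → Term I
  bounded r p zero    = ⊥ᵗ
  bounded r p (suc n) = p ∧ᵗ □ r (bounded r p n)

  bounded-⟦⟧ : ∀ σ r p n → σ ⟦ bounded r p n ⟧ ≡ bounded r (σ ⟦ p ⟧) n
  bounded-⟦⟧ σ r p zero    = refl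
  bounded-⟦⟧ σ r p (suc n) = cong (λ t → (σ ⟦ p ⟧) ∧ᵗ □ r t) (bounded-⟦⟧ σ r p n)

  -- Order laws in a model of `K`.

  module Model (A : Algebra I) (M : IsModel (K I) A) where
    open Algebra A using (eval; Carrier; ⊤ᴬ; ⊥ᴬ; ¬ᴬ; ∧ᴬ; ∨ᴬ; □ᴬ; □-cong)

    open Biased (Algebra._≈_ A) using (isBooleanAlgebraʳ)

    private
      valuation : Carrier → Carrier → Carrier → ℕ → Carrier
      valuation a b c 0 = a
      valuation a b c 1 = b
      valuation a b c _ = c

    booleanAlgebra : BooleanAlgebra _ _
    booleanAlgebra = record
      { _∨_ = ∨ᴬ ; _∧_ = ∧ᴬ ; ¬_ = ¬ᴬ ; ⊤ = ⊤ᴬ ; ⊥ = ⊥ᴬ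
      ; isBooleanAlgebra = isBooleanAlgebraʳ record
        { isDistributiveLattice = record
          { isLattice = record
            { isEquivalence = Algebra.isEquivalence A
            ; ∨-comm  = λ a b → M ∨-comm (valuation a b b)
            ; ∨-assoc = λ a b c → M ∨-assoc (valuation a b c)
            ; ∨-cong  = Algebra.∨-cong A
            ; ∧-comm  = λ a b → M ∧-comm (valuation a b b)
            ; ∧-assoc = λ a b c → M ∧-assoc (valuation a b c)
            ; ∧-cong  = Algebra.∧-cong A
            ; absorptive = (λ a b → M ∨-absorbs-∧ (valuation a b b))
                         , (λ a b → M ∧-absorbs-∨ (valuation a b b))
            }
          ; ∨-distrib-∧ = comm∧distrˡ⇒distr (Algebra.setoid A) (Algebra.∧-cong A)
              (λ a b → M ∨-comm (valuation a b b)) (λ a b c → M ∨-distribˡ-∧ (valuation a b c))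
          ; ∧-distrib-∨ = comm∧distrˡ⇒distr (Algebra.setoid A) (Algebra.∨-cong A)
              (λ a b → M ∧-comm (valuation a b b)) (λ a b c → M ∧-distribˡ-∨ (valuation a b c))
          }
        ; ∨-complementʳ = λ a → M ∨-complementʳ (valuation a a a)
        ; ∧-complementʳ = λ a → M ∧-complementʳ (valuation a a a)
        ; ¬-cong = Algebra.¬-cong A
        }
      }

    open BooleanProperties booleanAlgebra public
      using (∧-zeroˡ; ∧-identityˡ; ∧-identityʳ; ¬⊤≈⊥; ∨-∧-orderTheoreticLattice)
    -- The library's `a ⊑ b` unfolds to `a ≈ ∧ᴬ a b`, the reverse of the equation in `≼`; hence the
    -- many uses of symmetry below.
    open Order.Lattice ∨-∧-orderTheoreticLattice public
      using (meetSemilattice; antisym; x∧y≤x; x∧y≤y; ∧-greatest)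
      renaming (_≤_ to _⊑_; refl to ⊑-refl; trans to ⊑-trans; reflexive to ⊑-reflexive)
    open MeetProperties meetSemilattice public using (∧-monotonic)

    ⊥-minimum : ∀ a → ⊥ᴬ ⊑ a
    ⊥-minimum a = Algebra.sym A (∧-zeroˡ a)

    ⊤-maximum : ∀ a → a ⊑ ⊤ᴬ
    ⊤-maximum a = Algebra.sym A (∧-identityʳ a)

    □-monotonic : ∀ r {a b} → a ⊑ b → □ᴬ r a ⊑ □ᴬ r b
    □-monotonic r {a} {b} a⊑b =
      Algebra.trans A (□-cong r a⊑b) (M (□-∧ r) (valuation a b b))

    module _ (r : I) (ρ : ℕ → Carrier) where

      bounded-increasing : ∀ p n → eval ρ (bounded r p n) ⊑ eval ρ (bounded r p (suc n))
      bounded-increasing p zero    = ⊥-minimum _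
      bounded-increasing p (suc n) = ∧-monotonic ⊑-refl (□-monotonic r (bounded-increasing p n))

      -- The box of stage `n` is a conjunct of stage `suc n`. This makes every approximant solve the
      -- problem.
      bounded⊑□bounded : ∀ p n → eval ρ (bounded r p n) ⊑ □ᴬ r (eval ρ (bounded r p n))
      bounded⊑□bounded p n = ⊑-trans (bounded-increasing p n) (x∧y≤y _ _)

      bounded⊑ : ∀ p n → eval ρ (bounded r p n) ⊑ eval ρ p
      bounded⊑ p zero    = ⊥-minimum _
      bounded⊑ p (suc n) = x∧y≤x _ _

      -- An element below its own box persists along all `r`-paths, so only the bound on their
      -- length is left to impose. Since the box commutes with meets, the induction hypothesis
      -- applies under it.
      ∧-bounded : ∀ {p} → eval ρ p ⊑ □ᴬ r (eval ρ p) → ∀ n →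
                  ∧ᴬ (eval ρ p) (eval ρ (bounded r ⊤ᵗ n)) ⊑ eval ρ (bounded r p n)
      ∧-bounded p⊑□p zero    = x∧y≤y _ _
      ∧-bounded {p} p⊑□p (suc n) = ∧-greatest (x∧y≤x _ _)
        (⊑-trans
          (⊑-trans (∧-monotonic p⊑□p (x∧y≤y _ _))
            (⊑-reflexive (Algebra.sym A (M (□-∧ r) (valuation (eval ρ p) (eval ρ (bounded r ⊤ᵗ n)) ⊤ᴬ)))))
          (□-monotonic r (∧-bounded p⊑□p n)))

  -- Layered models.

  -- Layer 0 consists of dead ends; the accessibility relations of A lead from
  -- layer i + 1 to layer i.
  layered : Algebra I → Algebra I
  layered A = record
    { setoid = Indexed.≡-setoid ℕ (Trivial.indexedSetoid setoid)
    ; ⊤ᴬ = λ _ → ⊤ᴬ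
    ; ⊥ᴬ = λ _ → ⊥ᴬ
    ; ¬ᴬ = λ a i → ¬ᴬ (a i)
    ; □ᴬ = λ where
        r a zero    → ⊤ᴬ
        r a (suc i) → □ᴬ r (a i)
    ; ◇ᴬ = λ where
        r a zero    → ⊥ᴬ
        r a (suc i) → ◇ᴬ r (a i)
    ; ∧ᴬ = λ a b i → ∧ᴬ (a i) (b i)
    ; ∨ᴬ = λ a b i → ∨ᴬ (a i) (b i)
    ; ¬-cong = λ a≈b i → ¬-cong (a≈b i)
    ; □-cong = λ where
        r a≈b zero    → Algebra.refl A
        r a≈b (suc i) → □-cong r (a≈b i)
    ; ◇-cong = λ where
        r a≈b zero    → Algebra.refl A
        r a≈b (suc i) → ◇-cong r (a≈b i)
    ; ∧-cong = λ a≈b c≈d i → ∧-cong (a≈b i) (c≈d i)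
    ; ∨-cong = λ a≈b c≈d i → ∨-cong (a≈b i) (c≈d i)
    }
    where open Algebra A hiding (sym; trans; refl)

  -- Boolean axioms hold layer by layer. A modal axiom at layer `suc i` is that axiom of `A` at
  -- layer `i`; at layer 0 it only relates constants.
  layered-isModel : ∀ A → IsModel (K I) A → IsModel (K I) (layered A)
  layered-isModel A M = λ where
      ∨-comm        ρ i       → M ∨-comm (λ x → ρ x i)
      ∨-assoc       ρ i       → M ∨-assoc (λ x → ρ x i)
      ∧-comm        ρ i       → M ∧-comm (λ x → ρ x i)
      ∧-assoc       ρ i       → M ∧-assoc (λ x → ρ x i)
      ∨-absorbs-∧   ρ i       → M ∨-absorbs-∧ (λ x → ρ x i)
      ∧-absorbs-∨   ρ i       → M ∧-absorbs-∨ (λ x → ρ x i)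
      ∨-distribˡ-∧  ρ i       → M ∨-distribˡ-∧ (λ x → ρ x i)
      ∧-distribˡ-∨  ρ i       → M ∧-distribˡ-∨ (λ x → ρ x i)
      ∨-complementʳ ρ i       → M ∨-complementʳ (λ x → ρ x i)
      ∧-complementʳ ρ i       → M ∧-complementʳ (λ x → ρ x i)
      (□-∧ r)       ρ zero    → Algebra.sym A (∧-identityˡ ⊤ᴬ)
      (□-∧ r)       ρ (suc i) → M (□-∧ r) (λ x → ρ x i)
      (□-⊤ r)       ρ zero    → Algebra.refl A
      (□-⊤ r)       ρ (suc i) → M (□-⊤ r) (λ x → ρ x i)
      (◇-def r)     ρ zero    → Algebra.sym A ¬⊤≈⊥
      (◇-def r)     ρ (suc i) → M (◇-def r) (λ x → ρ x i)
    where
    open Algebra A using (⊤ᴬ)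
    open Model A M

  module _ (A : Algebra I) where
    open Algebra A using (_≈_; eval; Carrier; ¬-cong; □-cong; ◇-cong; ∧-cong; ∨-cong)
    open Algebra (layered A) using () renaming (eval to evalᴸ; Carrier to Carrierᴸ)

    -- Boxes and diamonds are constant at layer 0, so no other layer is seen from there.
    eval-bottom : ∀ {μ ν : ℕ → Carrierᴸ} → (∀ x → μ x 0 ≈ ν x 0) →
                  ∀ s → evalᴸ μ s 0 ≈ evalᴸ ν s 0
    eval-bottom μ≈ν (var x)  = μ≈ν x
    eval-bottom μ≈ν ⊤ᵗ       = Algebra.refl A
    eval-bottom μ≈ν ⊥ᵗ       = Algebra.refl A
    eval-bottom μ≈ν (¬ᵗ s)   = ¬-cong (eval-bottom μ≈ν s)
    eval-bottom μ≈ν (□ r s)  = Algebra.refl A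
    eval-bottom μ≈ν (◇ r s)  = Algebra.refl A
    eval-bottom μ≈ν (s ∧ᵗ t) = ∧-cong (eval-bottom μ≈ν s) (eval-bottom μ≈ν t)
    eval-bottom μ≈ν (s ∨ᵗ t) = ∨-cong (eval-bottom μ≈ν s) (eval-bottom μ≈ν t)

    -- Each modality descends one layer. From layer `suc i`, at most `i` descents lead no lower than
    -- layer 1, where `μ` still agrees with `ρ`.
    eval-above-bottom : ∀ {μ : ℕ → Carrierᴸ} {ρ : ℕ → Carrier} → (∀ x i → μ x (suc i) ≈ ρ x) →
                        ∀ s {i} → depth s ≤ i → evalᴸ μ s (suc i) ≈ eval ρ s
    eval-above-bottom μ≈ρ (var x)  d≤i       = μ≈ρ x _
    eval-above-bottom μ≈ρ ⊤ᵗ       d≤i       = Algebra.refl A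
    eval-above-bottom μ≈ρ ⊥ᵗ       d≤i       = Algebra.refl A
    eval-above-bottom μ≈ρ (¬ᵗ s)   d≤i       = ¬-cong (eval-above-bottom μ≈ρ s d≤i)
    eval-above-bottom μ≈ρ (□ r s)  (s≤s d≤i) = □-cong r (eval-above-bottom μ≈ρ s d≤i)
    eval-above-bottom μ≈ρ (◇ r s)  (s≤s d≤i) = ◇-cong r (eval-above-bottom μ≈ρ s d≤i)
    eval-above-bottom μ≈ρ (s ∧ᵗ t) d≤i       =
      ∧-cong (eval-above-bottom μ≈ρ s (m⊔n≤o⇒m≤o _ _ d≤i))
             (eval-above-bottom μ≈ρ t (m⊔n≤o⇒n≤o (depth s) _ d≤i))
    eval-above-bottom μ≈ρ (s ∨ᵗ t) d≤i       =
      ∨-cong (eval-above-bottom μ≈ρ s (m⊔n≤o⇒m≤o _ _ d≤i))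
             (eval-above-bottom μ≈ρ t (m⊔n≤o⇒n≤o (depth s) _ d≤i))

  -- The bound pulled up from the bottom layer.

  infix 4 _≼_

  _≼_ : Term I → Term I → Set₁
  s ≼ t = K I ⊢ (s ∧ᵗ t) ≈ s

  ≼□⇒≼bounded : ∀ r φ λˢ → φ ≼ □ r φ → K I ⊢ λˢ ⟦ φ ⟧ ≈ ⊥ᵗ →
                φ ≼ bounded r ⊤ᵗ (suc (depth φ))
  ≼□⇒≼bounded r φ λˢ φ≼□φ λφ≈⊥ A M ρ = Algebra.sym A
      -- Layer `suc (depth φ)` is the lowest that `eval-above-bottom` covers.
      (⊑-trans (⊑-reflexive (Algebra.sym A (eval-above-bottom A (λ _ _ → Algebra.refl A) φ ≤-refl)))
        (layer⊑bounded (suc (depth φ))))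
    where
    open Algebra A using (eval; Carrier; ⊥ᴬ; _≈_)
    open Model A M
    open Algebra (layered A) using () renaming (eval to evalᴸ; Carrier to Carrierᴸ)

    M′ : IsModel (K I) (layered A)
    M′ = layered-isModel A M

    -- Any valuation would serve: `λˢ ⟦ φ ⟧` is bottom under all of them.
    ν : ℕ → Carrierᴸ
    ν _ _ = ⊥ᴬ

    μ : ℕ → Carrierᴸ
    -- With variables read through `λˢ`, `φ` takes at the bottom the value of `λˢ ⟦ φ ⟧` under `ν`.
    μ x zero    = evalᴸ ν (map λˢ x) 0
    μ x (suc i) = ρ x

    bottom : evalᴸ μ φ 0 ≈ ⊥ᴬ
    bottom = Algebra.trans A (eval-bottom A (λ _ → Algebra.refl A) φ)
      (subst (λ a → a 0 ≈ ⊥ᴬ) (eval-⟦⟧ (layered A) λˢ ν φ) (λφ≈⊥ (layered A) M′ ν 0))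

    layer⊑bounded : ∀ i → evalᴸ μ φ i ⊑ eval ρ (bounded r ⊤ᵗ i)
    layer⊑bounded zero    = ⊑-reflexive bottom
    layer⊑bounded (suc i) = ∧-greatest (⊤-maximum _)
      -- The box of `φ` at layer `suc i` is the box in `A` of its value at layer `i`, so each climb
      -- puts one more box before bottom.
      (⊑-trans (Algebra.sym A (φ≼□φ (layered A) M′ μ (suc i))) (□-monotonic r (layer⊑bounded i)))

  -- A chain separating consecutive stages.

  -- One reflexive point, so that its layers form a chain.
  booleans : Algebra I
  booleans = record
    { setoid = ≡.setoid Bool
    ; ⊤ᴬ = true ; ⊥ᴬ = false ; ¬ᴬ = not
    ; □ᴬ = λ _ a → a ; ◇ᴬ = λ _ a → a
    ; ∧ᴬ = _∧_ ; ∨ᴬ = _∨_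
    ; ¬-cong = cong not
    ; □-cong = λ _ a≡b → a≡b
    ; ◇-cong = λ _ a≡b → a≡b
    ; ∧-cong = cong₂ _∧_
    ; ∨-cong = cong₂ _∨_
    }

  booleans-isModel : IsModel (K I) booleans
  booleans-isModel ∨-comm        ρ = Bool.∨-comm (ρ 0) (ρ 1)
  booleans-isModel ∨-assoc       ρ = Bool.∨-assoc (ρ 0) (ρ 1) (ρ 2)
  booleans-isModel ∧-comm        ρ = Bool.∧-comm (ρ 0) (ρ 1)
  booleans-isModel ∧-assoc       ρ = Bool.∧-assoc (ρ 0) (ρ 1) (ρ 2)
  booleans-isModel ∨-absorbs-∧   ρ = Bool.∨-abs-∧ (ρ 0) (ρ 1)
  booleans-isModel ∧-absorbs-∨   ρ = Bool.∧-abs-∨ (ρ 0) (ρ 1)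
  booleans-isModel ∨-distribˡ-∧  ρ = Bool.∨-distribˡ-∧ (ρ 0) (ρ 1) (ρ 2)
  booleans-isModel ∧-distribˡ-∨  ρ = Bool.∧-distribˡ-∨ (ρ 0) (ρ 1) (ρ 2)
  booleans-isModel ∨-complementʳ ρ = Bool.∨-inverseʳ (ρ 0)
  booleans-isModel ∧-complementʳ ρ = Bool.∧-inverseʳ (ρ 0)
  booleans-isModel (□-∧ r)       ρ = refl
  booleans-isModel (□-⊤ r)       ρ = refl
  booleans-isModel (◇-def r)     ρ = sym (Bool.not-involutive (ρ 0))

  chain : Algebra I
  chain = layered booleans

  -- The problem and its unifiers.

  module _ (r : I) where

    -- The longest path from layer `n` of the chain has exactly `suc n` points, and `var 0` is made
    -- true on all of them.
    bounded-⋠ : ∀ n → ¬ bounded r (var 0) (suc n) ≼ bounded r ⊤ᵗ n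
    bounded-⋠ n ≼ = contradiction
      (trans (sym (cong₂ _∧_ (holds n) (fails n)))
        (trans (≼ chain (layered-isModel booleans booleans-isModel) always n) (holds n)))
      λ ()
      where
      open Algebra chain using (eval; Carrier)

      always : ℕ → Carrier
      always _ _ = true

      holds : ∀ i → eval always (bounded r (var 0) (suc i)) i ≡ true
      holds zero    = refl
      holds (suc i) = holds i

      fails : ∀ i → eval always (bounded r ⊤ᵗ i) i ≡ false
      fails zero    = refl
      fails (suc i) = fails i

    problem : Problem I
    problem = (var 0 ∧ᵗ □ r (var 0) , var 0) ∷ []

    approximant : ℕ → Subst I
    approximant n = bounded r (var 0) n ↦₀

    approximant-unifier : ∀ n → Unifier (K I) problem (approximant n)
    approximant-unifier n =
      (λ A M ρ → Algebra.sym A (Model.bounded⊑□bounded A M r ρ (var 0) n)) ∷ []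

    -- The witness is `τ` itself. It turns stage `n` for `var 0` into stage `n` for `map τ 0`, which
    -- equals `map τ 0` by `bounded⊑` and `∧-bounded`. The approximant fixes all other variables, so
    -- any `X` is allowed.
    approximant-moreGeneral : ∀ X τ n → Unifier (K I) problem τ → map τ 0 ≼ bounded r ⊤ᵗ n →
                              MoreGeneral (K I) X (approximant n) τ
    approximant-moreGeneral X τ n (φ≼□φ ∷ []) φ≼bounded = τ , λ where
      zero    _ A M ρ → let open Model A M in
        subst (λ t → Algebra._≈_ A (Algebra.eval A ρ t) (Algebra.eval A ρ (map τ 0)))
          (sym (bounded-⟦⟧ τ r (var 0) n))
          (antisym (bounded⊑ r ρ (map τ 0) n)
            (⊑-trans (∧-greatest ⊑-refl (Algebra.sym A (φ≼bounded A M ρ)))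
              (∧-bounded r ρ {map τ 0} (Algebra.sym A (φ≼□φ A M ρ)) n)))
      (suc x) _ A M ρ → Algebra.refl A

    no-minimalComplete : ∀ {ℓ} (X : Pred ℕ _) → X 0 → (S : Pred (Subst I) ℓ) →
                         ¬ IsMinimalComplete (K I) problem X S
    no-minimalComplete X X0 S mc with IsMinimalComplete.complete mc _ (approximant-unifier 0)
    ... | τ , Sτ , α , ατ≈⊥ with IsMinimalComplete.unifiers mc τ Sτ
    ... | τ-unifier@(φ≼□φ ∷ []) with ≼□⇒≼bounded r (map τ 0) α φ≼□φ (ατ≈⊥ 0 X0)
    ... | φ≼bounded
        -- One stage beyond the bound on `map τ 0`: still more general than `τ`, yet not below that
        -- bound, which forces `τ′` to differ from `τ`.
        with IsMinimalComplete.complete mc _ (approximant-unifier (suc (suc (depth (map τ 0)))))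
    ... | τ′ , Sτ′ , τ′-moreGeneral@(β , βτ′≈) =
      IsMinimalComplete.minimal mc τ′ τ Sτ′ Sτ τ′≢τ
        (inj₁ (MoreGeneral-trans (K I) X τ′ (approximant (suc n)) τ τ′-moreGeneral
          (approximant-moreGeneral X τ (suc n) τ-unifier φ≼bounded⁺)))
      where
      n = suc (depth (map τ 0))

      φ≼bounded⁺ : map τ 0 ≼ bounded r ⊤ᵗ (suc n)
      φ≼bounded⁺ A M ρ = let open Model A M in Algebra.sym A
        (⊑-trans (Algebra.sym A (φ≼bounded A M ρ)) (bounded-increasing r ρ ⊤ᵗ n))

      τ′≢τ : ¬ map τ′ ≗ map τ
      -- If they agreed, `β` would send `map τ 0` to stage `suc n`. Applying `β` to `φ≼bounded`,
      -- whose right side is closed, would put that stage below the bound.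
      τ′≢τ τ′≗τ = bounded-⋠ n λ A M ρ →
        let open Algebra A using (_≈_; eval; ∧-cong)
            βφ≈ : eval ρ (β ⟦ map τ 0 ⟧) ≈ eval ρ (bounded r (var 0) (suc n))
            βφ≈ = subst (λ t → eval ρ (β ⟦ t ⟧) ≈ _) (τ′≗τ 0) (βτ′≈ 0 X0 A M ρ)
        in Algebra.trans A
             (∧-cong (Algebra.sym A βφ≈)
               (Algebra.reflexive A (cong (eval ρ) (sym (bounded-⟦⟧ β r ⊤ᵗ n)))))
             (Algebra.trans A (⊢-⟦⟧ β (map τ 0 ∧ᵗ bounded r ⊤ᵗ n) (map τ 0) φ≼bounded A M ρ) βφ≈)

    worstType-zero : ∀ {ℓ} X → X problem 0 → WorstType (K I) ℓ X zero
    worstType-zero X X0 =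
      ( problem , (approximant 0 , approximant-unifier 0)
      , λ (S , mc) → no-minimalComplete (X problem) X0 S mc ) ,
      λ _ u _ _ → rank≤3 u
      where
      rank≤3 : ∀ u → u ≤ᵁ zero
      rank≤3 unitary    = z≤n
      rank≤3 finitary   = s≤s z≤n
      rank≤3 infinitary = s≤s (s≤s z≤n)
      rank≤3 zero       = ≤-refl

  -- A worst type is attained, so any two bound each other. Coincidence of the restricted and
  -- unrestricted types thus reduces to both being zero.
  worstType-unique : ∀ {E : Theory I} {ℓ X t u} → WorstType E ℓ X t → WorstType E ℓ X u → t ≡ u
  worstType-unique ((Γ , solvable , Γ:t) , ≤t) ((Δ , solvable′ , Δ:u) , ≤u) =
    rank-injective (≤-antisym (≤u Γ _ solvable Γ:t) (≤t Δ _ solvable′ Δ:u))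
    where
    rank-injective : ∀ {t u} → rank t ≡ rank u → t ≡ u
    rank-injective {unitary}    {unitary}    _ = refl
    rank-injective {finitary}   {finitary}   _ = refl
    rank-injective {infinitary} {infinitary} _ = refl
    rank-injective {zero}       {zero}       _ = refl

corollary4p7 : (ℓ : Level) (k : ℕ) →
    (∀ t → RestrictedType (K (Fin (suc k))) ℓ t ⇔ UnrestrictedType (K (Fin (suc k))) ℓ t)
    × RestrictedType (K (Fin (suc k))) ℓ zero
    × UnrestrictedType (K (Fin (suc k))) ℓ zero
corollary4p7 ℓ k =
  (λ t → mk⇔
    (λ restricted →
      subst (UnrestrictedType _ ℓ) (worstType-unique restrictedZero restricted) unrestrictedZero)
    (λ unrestricted →
      subst (RestrictedType _ ℓ) (worstType-unique unrestrictedZero unrestricted) restrictedZero)) ,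
  restrictedZero , unrestrictedZero
  where
  restrictedZero : RestrictedType (K (Fin (suc k))) ℓ zero
  -- The index set is non-empty, which supplies a modality for the problem.
  restrictedZero = worstType-zero Fin.zero Var (here refl)

  unrestrictedZero : UnrestrictedType (K (Fin (suc k))) ℓ zero
  unrestrictedZero = worstType-zero Fin.zero (λ _ → U) tt
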